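{- Let $t \in \Sigma^*$ be a finite trace. Then, for all LTL formulae $\varphi$ and $\varphi'$ with $\varphi \xrightarrow{t} \varphi'$: (1) $t \in [\![\varphi]\!]_3(\mathrm{T})$ if and only if $[\![\varphi']\!]_3(\mathrm{T}) = \Sigma^\infty$; (2) $t \in [\![\varphi]\!]_3(\mathrm{F})$ if and only if $[\![\varphi']\!]_3(\mathrm{F}) = \Sigma^\infty$.
   Context: Traces. Fix a set $A$ of atomic propositions and let $\Sigma = \mathcal{P}(A)$ be the set of states. $\Sigma^*$ is the set of finite traces (including the empty trace $\varepsilon$), $\Sigma^\omega$ the set of infinite traces, $\Sigma^\infty = \Sigma^* \cup \Sigma^\omega$. Concatenation is written $tu$, with $tu = t$ if $t$ is infinite. $t_0$ is the first state of a nonempty trace $t$; $t|_n$ is $t$ without its first $n$ states ($\varepsilon$ if $n$ exceeds the length of $t$). Definitive sets. For $X \subseteq \Sigma^\infty$, $\downarrow X = \{u \mid \exists t \in X.\ \exists v \in \Sigma^\infty.\ t = uv\}$; $\uparrow t = \{tu \mid u \in \Sigma^\infty\}$; $\mathrm{dp}(X) = \{t \in \Sigma^\infty\mid \uparrow t \subseteq \downarrow X\}$. $X$ is definitive iff $X = \mathrm{dp}(X)$. Definitive union: $X \sqcup Y = \mathrm{dp}(X \cup Y)$ and $\bigsqcup S = \mathrm{dp}(\bigcup S)$. Prepend: $\triangleright X = \{t \in \Sigma^\infty \mid t|_1 \in X\}$. LTL formulae: $\varphi,\psi ::= \top \mid a \mid \neg\varphi \mid \varphi\wedge\psi \mid \bigcirc\varphi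 \mid \varphi\,\mathcal{U}\,\psi$ with $a \in A$; $\bot$ abbreviates $\neg\top$ and $\varphi\vee\psi$ abbreviates $\neg(\neg\varphi\wedge\neg\psi)$. LTL$_3$ semantics $[\![\varphi]\!]_3$ assigns to each answer in $\{\mathrm{T},\mathrm{F}\}$ a definitive set, by recursion: $[\![\top]\!]_3(\mathrm{T}) = \Sigma^\infty$, $[\![\top]\!]_3(\mathrm{F}) = \emptyset$; $[\![a]\!]_3(\mathrm{T}) = \mathrm{dp}\{t\in\Sigma^\infty \mid t\ne\varepsilon \wedge a \in t_0\}$, $[\![a]\!]_3(\mathrm{F}) = \mathrm{dp}\{t\in\Sigma^\infty \mid t\neq\varepsilon \wedge a \notin t_0\}$; $[\![\neg\varphi]\!]_3(\mathrm{T}) = [\![\varphi]\!]_3(\mathrm{F})$, $[\![\neg\varphi]\!]_3(\mathrm{F}) = [\![\varphi]\!]_3(\mathrm{T})$; $[\![\varphi\wedge\psi]\!]_3(\mathrm{T}) = [\![\varphi]\!]_3(\mathrm{T})\cap[\![\psi]\!]_3(\mathrm{T})$, $[\![\varphi\wedge\psi]\!]_3(\mathrm{F}) = [\![\varphi]\!]_3(\mathrm{F})\sqcup[\![\psi]\!]_3(\mathrm{F})$; (consequently $[\![\varphi\vee\psi]\!]_3(\mathrm{T}) = [\![\varphi]\!]_3(\mathrm{T})\sqcup[\![\psi]\!]_3(\mathrm{T})$, $[\![\varphi\vee\psi]\!]_3(\mathrm{F}) = [\![\varphi]\!]_3(\mathrm{F})\cap[\![\psi]\!]_3(\mathrm{F})$);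 $[\![\bigcirc\varphi]\!]_3(b) = \triangleright([\![\varphi]\!]_3(b))$ for $b\in\{\mathrm{T},\mathrm{F}\}$; $[\![\varphi\,\mathcal{U}\,\psi]\!]_3(\mathrm{T}) = \bigsqcup_{k\in\mathbb{N}} f^k([\![\psi]\!]_3(\mathrm{T}))$ where $f(X) = \triangleright X \cap [\![\varphi]\!]_3(\mathrm{T})$; $[\![\varphi\,\mathcal{U}\,\psi]\!]_3(\mathrm{F}) = \bigcap_{k\in\mathbb{N}} g^k([\![\psi]\!]_3(\mathrm{F}))$ where $g(X) = \triangleright X \sqcup [\![\varphi]\!]_3(\mathrm{F})$. Here $f^k$ is the $k$-fold self-composition of $f$ ($f^0$ the identity). Formula progression. For $\sigma\in\Sigma$, the relation $\varphi \xrightarrow{\sigma} \varphi'$ (a total function of $(\varphi,\sigma)$) is given by the rules: $\top \xrightarrow{\sigma} \top$; $a \xrightarrow{\sigma} \top$ if $a \in \sigma$; $a \xrightarrow{\sigma} \bot$ if $a \notin\sigma$; $\bigcirc\varphi \xrightarrow{\sigma} \varphi$; if $\varphi \xrightarrow{\sigma}\varphi'$ then $\neg\varphi \xrightarrow{\sigma} \neg\varphi'$; if $\varphi \xrightarrow{\sigma}\varphi'$ and $\psi\xrightarrow{\sigma}\psi'$ then $\varphi\wedge\psi \xrightarrow{\sigma} \varphi'\wedge\psi'$ and $\varphi\,\mathcal{U}\,\psi \xrightarrow{\sigma} \psi' \vee (\varphi' \wedge (\varphi\,\mathcal{U}\,\psi))$. For a finite trace $t = \sigma_0\cdots\sigma_n$,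 $\varphi\xrightarrow{t}\psi$ means $\varphi \xrightarrow{\sigma_0}\cdots\xrightarrow{\sigma_n}\psi$ (successive progression through intermediate formulae); $\varphi \xrightarrow{\varepsilon}\psi$ means $\psi = \varphi$. -}

module Defs where

open import Data.List.Base as List using (List; []; _∷_; _++_)
open import Data.List.Relation.Binary.Pointwise using (Pointwise)
open import Data.Nat.Base using (ℕ; zero; suc; _+_)
open import Data.Product.Base using (_×_; _,_; ∃-syntax; Σ-syntax)
import Function.Endo.Propositional as Endo
open import Level using (Level) renaming (suc to lsuc)
open import Relation.Binary.PropositionalEquality.Core using (_≢_; refl)
open import Relation.Nullary.Negation using (contradiction)
open import Relation.Unary
  using (Pred; _∈_; _∉_; _⊆_; _≐_; _∩_; _∪_; ⋃; ⋂)
open import Relation.Unary.Polymorphic using (∅; U)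

private
  variable
    a : Level
    A : Set a

-- The powerset of A; states are compared extensionally, by _≐_.

State : Set a → Set (lsuc a)
State {a} A = Pred A a

data Trace (A : Set a) : Set (lsuc a) where
  fin : List (State A) → Trace A
  inf : (ℕ → State A)  → Trace A

ε : Trace A
ε = fin []

-- Equality of traces as sequences of states.  Propositional equality would
-- be too fine, as neither _≐_ nor pointwise equality of functions implies it.

infix 4 _≈_

data _≈_ {A : Set a} : Trace A → Trace A → Set (lsuc a) where
  fin : ∀ {s t} → Pointwise _≐_ s t → fin s ≈ fin t
  inf : ∀ {v w} → (∀ n → v n ≐ w n) → inf v ≈ inf w

infixr 5 _++ω_ _·_

_++ω_ : List (State A) → (ℕ → State A) → (ℕ → State A)
([]      ++ω w) n       = w n
((σ ∷ s) ++ω w) zero    = σ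
((σ ∷ s) ++ω w) (suc n) = (s ++ω w) n

_·_ : Trace A → Trace A → Trace A
fin s · fin t = fin (s ++ t)
fin s · inf w = inf (s ++ω w)
inf w · _     = inf w

first : (t : Trace A) → t ≢ ε → State A
first (fin [])      t≢ε = contradiction refl t≢ε
first (fin (σ ∷ _)) _   = σ
first (inf w)       _   = w 0

drop : ℕ → Trace A → Trace A
drop n (fin s) = fin (List.drop n s)
drop n (inf w) = inf (λ k → w (n + k))

TraceSet : Set a → Set (lsuc (lsuc a))
TraceSet {a} A = Pred (Trace A) (lsuc a)

Σ∞ : TraceSet A
Σ∞ = U

infixr 8 ↓_ ↑_ ▷_

↓_ : TraceSet A → TraceSet A
(↓ X) u = ∃[ t ] t ∈ X × ∃[ v ] t ≈ u · v

↑_ : Trace A → TraceSet A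
(↑ t) w = ∃[ u ] w ≈ t · u

dp : TraceSet A → TraceSet A
dp X t = ↑ t ⊆ ↓ X

infixr 6 _⊔_

_⊔_ : TraceSet A → TraceSet A → TraceSet A
X ⊔ Y = dp (X ∪ Y)

⨆ : (ℕ → TraceSet A) → TraceSet A
⨆ X = dp (⋃ ℕ X)

▷_ : TraceSet A → TraceSet A
(▷ X) t = drop 1 t ∈ X

infixr 9 _^_

_^_ : (TraceSet A → TraceSet A) → ℕ → TraceSet A → TraceSet A
_^_ {A = A} = Endo._^_ (TraceSet A)

infixr 9 ¬_ ◯_
infixr 8 _𝓤_
infixr 7 _∧_
infixr 6 _∨_

data Formula (A : Set a) : Set a where
  ⊤    : Formula A
  atom : A → Formula A
  ¬_   : Formula A → Formula A
  _∧_  : Formula A → Formula A → Formula A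
  ◯_   : Formula A → Formula A
  _𝓤_  : Formula A → Formula A → Formula A

⊥ : Formula A
⊥ = ¬ ⊤

_∨_ : Formula A → Formula A → Formula A
φ ∨ ψ = ¬ (¬ φ ∧ ¬ ψ)

data Answer : Set where
  T F : Answer

⟦_⟧₃ : Formula A → Answer → TraceSet A
⟦ ⊤ ⟧₃      T = Σ∞
⟦ ⊤ ⟧₃      F = ∅
⟦ atom p ⟧₃ T = dp (λ t → Σ[ t≢ε ∈ t ≢ ε ] p ∈ first t t≢ε)
⟦ atom p ⟧₃ F = dp (λ t → Σ[ t≢ε ∈ t ≢ ε ] p ∉ first t t≢ε)
⟦ ¬ φ ⟧₃    T = ⟦ φ ⟧₃ F
⟦ ¬ φ ⟧₃    F = ⟦ φ ⟧₃ T
⟦ φ ∧ ψ ⟧₃  T = ⟦ φ ⟧₃ T ∩ ⟦ ψ ⟧₃ T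
⟦ φ ∧ ψ ⟧₃  F = ⟦ φ ⟧₃ F ⊔ ⟦ ψ ⟧₃ F
⟦ ◯ φ ⟧₃    b = ▷ ⟦ φ ⟧₃ b
⟦ φ 𝓤 ψ ⟧₃  T = ⨆ (λ k → ((λ X → ▷ X ∩ ⟦ φ ⟧₃ T) ^ k) (⟦ ψ ⟧₃ T))
⟦ φ 𝓤 ψ ⟧₃  F = ⋂ ℕ (λ k → ((λ X → ▷ X ⊔ ⟦ φ ⟧₃ F) ^ k) (⟦ ψ ⟧₃ F))

infix 4 _⟶[_]_ _⟶*[_]_

data _⟶[_]_ {A : Set a} : Formula A → State A → Formula A → Set (lsuc a) where
  ⊤-step  : ∀ {σ} → ⊤ ⟶[ σ ] ⊤
  ∈-step  : ∀ {σ p} → p ∈ σ → atom p ⟶[ σ ] ⊤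
  ∉-step  : ∀ {σ p} → p ∉ σ → atom p ⟶[ σ ] ⊥
  ◯-step  : ∀ {σ φ} → ◯ φ ⟶[ σ ] φ
  ¬-step  : ∀ {σ φ φ′} → φ ⟶[ σ ] φ′ → ¬ φ ⟶[ σ ] ¬ φ′
  ∧-step  : ∀ {σ φ φ′ ψ ψ′} → φ ⟶[ σ ] φ′ → ψ ⟶[ σ ] ψ′ →
            φ ∧ ψ ⟶[ σ ] φ′ ∧ ψ′
  𝓤-step  : ∀ {σ φ φ′ ψ ψ′} → φ ⟶[ σ ] φ′ → ψ ⟶[ σ ] ψ′ →
            φ 𝓤 ψ ⟶[ σ ] ψ′ ∨ (φ′ ∧ (φ 𝓤 ψ))

data _⟶*[_]_ {A : Set a} :
     Formula A → List (State A) → Formula A → Set (lsuc a) where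
  done : ∀ {φ} → φ ⟶*[ [] ] φ
  step : ∀ {σ t φ φ′ ψ} → φ ⟶[ σ ] φ′ → φ′ ⟶*[ t ] ψ → φ ⟶*[ σ ∷ t ] ψ

{-# OPTIONS --safe #-}

-- A definitive set is determined by its infinite members: t ∈ X exactly when
-- every infinite extension of t is in X.  On infinite traces dp changes
-- nothing, so ⊔ and ⨆ become plain unions and ⟦_⟧₃ becomes ordinary LTL, where
-- the expansion law of 𝓤 shows that t v satisfies φ iff v satisfies the
-- progression of φ by t.  Hence t ∈ ⟦ φ ⟧₃ b iff all v lie in ⟦ φ′ ⟧₃ b.

module Submission where

open import Defs
open import Axiom.ExcludedMiddle using (ExcludedMiddle)
open import Data.List.Base using (List; []; _∷_; _++_)
open import Data.List.Relation.Binary.Pointwise as Pointwise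
  using (Pointwise; []; _∷_)
open import Data.Nat.Base as ℕ using (ℕ; zero)
open import Data.Product.Base using (_×_; _,_; proj₁; proj₂; Σ-syntax)
open import Data.Product.Function.NonDependent.Propositional using (_×-⇔_)
open import Data.Sum.Base using (_⊎_; inj₁; inj₂; [_,_])
open import Data.Sum.Function.Propositional using (_⊎-⇔_)
open import Data.Unit.Polymorphic using (tt)
open import Function.Base using (_∘_; id)
open import Function.Bundles using (_⇔_; mk⇔; Equivalence)
open import Function.Construct.Composition using (_⇔-∘_)
open import Function.Construct.Identity using (⇔-id)
open import Function.Construct.Symmetry using (⇔-sym)
open import Level using (Level; suc)
open import Relation.Binary.Definitions using (_Respects_)
open import Relation.Binary.PropositionalEquality.Core using (_≢_; refl)
open import Relation.Nullary.Decidable.Core using (yes; no)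
open import Relation.Nullary.Negation using (contradiction)
open import Relation.Unary using (Pred; _∈_; _∉_; _≐_; _∩_; _∪_; ⋃; ⋂)
open import Relation.Unary.Polymorphic using (∅)
open import Relation.Unary.Properties using (≐-refl; ≐-sym; ≐-trans)

open Equivalence using (to; from)

private
  variable
    a : Level
    A : Set a
    X Y P Q X′ Y′ : TraceSet A
    v w : ℕ → State A

-- Equality of traces

≈-refl : {t : Trace A} → t ≈ t
≈-refl {t = fin _} = fin (Pointwise.refl ≐-refl)
≈-refl {t = inf _} = inf λ _ → ≐-refl

≈-sym : {s t : Trace A} → s ≈ t → t ≈ s
≈-sym (fin p) = fin (Pointwise.symmetric ≐-sym p)
≈-sym (inf p) = inf (≐-sym ∘ p)

≈-trans : {s t u : Trace A} → s ≈ t → t ≈ u → s ≈ u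
≈-trans (fin p) (fin q) = fin (Pointwise.transitive ≐-trans p q)
≈-trans (inf p) (inf q) = inf λ n → ≐-trans (p n) (q n)

++ω-congʳ : {s t : List (State A)} → Pointwise _≐_ s t →
            ∀ v n → (s ++ω v) n ≐ (t ++ω v) n
++ω-congʳ []      v n       = ≐-refl
++ω-congʳ (p ∷ _) v zero    = p
++ω-congʳ (_ ∷ p) v (ℕ.suc n) = ++ω-congʳ p v n

·-congʳ : {s t : Trace A} → s ≈ t → ∀ u → s · u ≈ t · u
·-congʳ (fin p) (fin u) = fin (Pointwise.++⁺ p (Pointwise.refl ≐-refl))
·-congʳ (fin p) (inf v) = inf (++ω-congʳ p v)
·-congʳ (inf p) _       = inf p

++ω-assoc : ∀ (s t : List (State A)) v n →
            ((s ++ t) ++ω v) n ≐ (s ++ω (t ++ω v)) n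
++ω-assoc []      t v n       = ≐-refl
++ω-assoc (_ ∷ s) t v zero    = ≐-refl
++ω-assoc (_ ∷ s) t v (ℕ.suc n) = ++ω-assoc s t v n

-- The last factor is infinite because definitive sets are tested on infinite extensions.
·-assoc-inf : ∀ (s t : Trace A) v → (s · t) · inf v ≈ s · (t · inf v)
·-assoc-inf (fin s) (fin t) v = inf (++ω-assoc s t v)
·-assoc-inf (fin s) (inf w) v = ≈-refl
·-assoc-inf (inf w) t       v = ≈-refl

drop-cong : {s t : Trace A} → s ≈ t → drop 1 s ≈ drop 1 t
drop-cong (fin [])      = ≈-refl
drop-cong (fin (_ ∷ p)) = fin p
drop-cong (inf p)       = inf (p ∘ ℕ.suc)

-- Definitive sets

-- For sets respecting _≈_, the fields extend and complete together are
-- equivalent to X ≐ dp X.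

record Definitive {A : Set a} (X : TraceSet A) : Set (suc (suc a)) where
  field
    resp     : X Respects _≈_
    extend   : ∀ t v → t ∈ X → t · inf v ∈ X
    complete : ∀ t → (∀ v → t · inf v ∈ X) → t ∈ X

open Definitive

dp-resp : dp X Respects _≈_
dp-resp s≈t s∈ (u , w≈) = s∈ (u , ≈-trans w≈ (·-congʳ (≈-sym s≈t) u))

-- An infinite trace has no proper extension, so a member of `X` that extends `t · inf v` equals it
-- up to `_≈_`. Splitting on `t` lets `t · inf v` reduce to an `inf`, which absorbs any later
-- factor.
dp-extend : X Respects _≈_ → ∀ t v → t ∈ dp X → t · inf v ∈ X
dp-extend r (fin s) v t∈ with t∈ (inf v , ≈-refl)
... | _ , x∈X , _ , x≈ = r x≈ x∈X
dp-extend r (inf w) v t∈ with t∈ (inf v , ≈-refl)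
... | _ , x∈X , _ , x≈ = r x≈ x∈X

-- Appending some infinite trace to an extension `w` of `t` yields an infinite extension of `t`. The
-- premise puts that trace in `X`, and `w` is a prefix of it. The choice of `v₀` is arbitrary.
dp-complete : ∀ (t : Trace A) → (∀ v → t · inf v ∈ X) → t ∈ dp X
dp-complete t h {w} (fin u , w≈) =
  _ , h _ , inf v₀ ,
  ≈-sym (≈-trans (·-congʳ w≈ (inf v₀)) (·-assoc-inf t (fin u) v₀))
  where v₀ = λ _ → ∅
dp-complete t h {w} (inf u , w≈) =
  _ , h u , inf v₀ ,
  ≈-sym (≈-trans (·-congʳ w≈ (inf v₀)) (·-assoc-inf t (inf u) v₀))
  where v₀ = λ _ → ∅

inf∈dp⇔ : X Respects _≈_ → inf v ∈ dp X ⇔ inf v ∈ X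
inf∈dp⇔ {v = v} r = mk⇔ (dp-extend r (inf v) v) (λ v∈ → dp-complete (inf v) λ _ → v∈)

-- Extending `t · inf v` once more leaves it unchanged up to `_≈_`, so both fields pass between `X`
-- and `dp X` along such trivial extensions.
dp-definitive : X Respects _≈_ → Definitive (dp X)
dp-definitive r .resp         = dp-resp
dp-definitive r .extend t v p = dp-complete (t · inf v) λ u →
  r (≈-sym (·-assoc-inf t (inf v) u)) (dp-extend r t v p)
dp-definitive r .complete t h = dp-complete t λ v →
  r (·-assoc-inf t (inf v) v) (dp-extend r (t · inf v) v (h v))

Σ∞-definitive : Definitive {A = A} Σ∞
Σ∞-definitive .resp _ _     = tt
Σ∞-definitive .extend _ _ _ = tt
Σ∞-definitive .complete _ _ = tt

∅-definitive : Definitive {A = A} ∅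
∅-definitive .resp _ ()
∅-definitive .extend _ _ ()
-- An infinite trace exists even over no propositions: every state may be empty. This refutes the
-- premise.
∅-definitive .complete _ h = h λ _ → ∅

∩-definitive : Definitive X → Definitive Y → Definitive (X ∩ Y)
∩-definitive dX dY .resp e (p , q)       = dX .resp e p , dY .resp e q
∩-definitive dX dY .extend t v (p , q)   = dX .extend t v p , dY .extend t v q
∩-definitive dX dY .complete t h         =
  dX .complete t (proj₁ ∘ h) , dY .complete t (proj₂ ∘ h)

⋂-definitive : {Z : ℕ → TraceSet A} → (∀ k → Definitive (Z k)) → Definitive (⋂ ℕ Z)
⋂-definitive d .resp e p k     = d k .resp e (p k)
⋂-definitive d .extend t v p k = d k .extend t v (p k)
⋂-definitive d .complete t h k = d k .complete t λ v → h v k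

▷-definitive : Definitive X → Definitive (▷ X)
▷-definitive d .resp                     = d .resp ∘ drop-cong
-- With nothing else to drop, `drop 1` removes the first state of `v` itself.
▷-definitive d .extend (fin [])      v   = d .extend ε (v ∘ ℕ.suc)
▷-definitive d .extend (fin (_ ∷ s)) v   = d .extend (fin s) v
▷-definitive d .extend (inf w)       v   = id
-- A dummy first state, which `drop 1` then removes, leaves exactly `v`.
▷-definitive d .complete (fin [])      h = d .complete ε λ v → h ((∅ ∷ []) ++ω v)
▷-definitive d .complete (fin (_ ∷ s)) h = d .complete (fin s) h
▷-definitive d .complete (inf w)       h = h w

∪-resp : X Respects _≈_ → Y Respects _≈_ → (X ∪ Y) Respects _≈_
∪-resp rX rY e = [ inj₁ ∘ rX e , inj₂ ∘ rY e ]

⋃-resp : {Z : ℕ → TraceSet A} → (∀ k → Z k Respects _≈_) → ⋃ ℕ Z Respects _≈_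
⋃-resp r e (k , p) = k , r k e p

⊔-definitive : Definitive X → Definitive Y → Definitive (X ⊔ Y)
⊔-definitive dX dY = dp-definitive (∪-resp (dX .resp) (dY .resp))

inf∈⊔⇔ : Definitive X → Definitive Y → inf v ∈ X ⊔ Y ⇔ (inf v ∈ X ⊎ inf v ∈ Y)
inf∈⊔⇔ dX dY = inf∈dp⇔ (∪-resp (dX .resp) (dY .resp))

-- Two different traces are allowed because progression compares a trace starting with `σ` to its
-- tail.
⊔-cong-inf : Definitive X → Definitive Y → Definitive X′ → Definitive Y′ →
             inf v ∈ X ⇔ inf w ∈ X′ → inf v ∈ Y ⇔ inf w ∈ Y′ →
             inf v ∈ X ⊔ Y ⇔ inf w ∈ X′ ⊔ Y′
⊔-cong-inf dX dY dX′ dY′ p q =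
  ⇔-sym (inf∈⊔⇔ dX′ dY′) ⇔-∘ ((p ⊎-⇔ q) ⇔-∘ inf∈⊔⇔ dX dY)

-- The common form of both atom clauses, with `S` the states that contain a proposition or those
-- that omit it.
First : ∀ {a} {A : Set a} → Pred (State A) a → TraceSet A
First S t = Σ[ t≢ε ∈ t ≢ ε ] S (first t t≢ε)

First-resp : ∀ {a} {A : Set a} {S : Pred (State A) a} → S Respects _≐_ → First S Respects _≈_
First-resp r (fin [])      (t≢ε , _) = contradiction refl t≢ε
First-resp r (fin (p ∷ _)) (_ , s)   = (λ ()) , r p s
First-resp r (inf p)       (_ , s)   = (λ ()) , r (p 0) s

-- Until and its dual

-- These are the two `𝓤` clauses of the semantics with the subformulae abstracted. On infinite
-- traces `Release P Q` is the release operator: `Q` holds up to and including the first point where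
-- `P` does, or forever.
Until Release : TraceSet A → TraceSet A → TraceSet A
Until   P Q = ⨆ (λ k → ((λ X → ▷ X ∩ P) ^ k) Q)
Release P Q = ⋂ ℕ (λ k → ((λ X → ▷ X ⊔ P) ^ k) Q)

until-iterate-definitive : Definitive P → Definitive Q →
                           ∀ k → Definitive (((λ X → ▷ X ∩ P) ^ k) Q)
until-iterate-definitive dP dQ zero    = dQ
until-iterate-definitive dP dQ (ℕ.suc k) =
  ∩-definitive (▷-definitive (until-iterate-definitive dP dQ k)) dP

release-iterate-definitive : Definitive P → Definitive Q →
                             ∀ k → Definitive (((λ X → ▷ X ⊔ P) ^ k) Q)
release-iterate-definitive dP dQ zero    = dQ
release-iterate-definitive dP dQ (ℕ.suc k) =
  ⊔-definitive (▷-definitive (release-iterate-definitive dP dQ k)) dP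

until-⋃-resp : Definitive P → Definitive Q →
               ⋃ ℕ (λ k → ((λ X → ▷ X ∩ P) ^ k) Q) Respects _≈_
until-⋃-resp dP dQ = ⋃-resp λ k → until-iterate-definitive dP dQ k .resp

until-definitive : Definitive P → Definitive Q → Definitive (Until P Q)
until-definitive dP dQ = dp-definitive (until-⋃-resp dP dQ)

release-definitive : Definitive P → Definitive Q → Definitive (Release P Q)
release-definitive dP dQ = ⋂-definitive (release-iterate-definitive dP dQ)

-- The index in the union is either `0`, giving `Q`, or a successor, whose iterate is by definition
-- `P` intersected with the shifted previous one.
until-expand : Definitive P → Definitive Q →
  inf v ∈ Until P Q ⇔ (inf v ∈ Q ⊎ (inf v ∈ P × inf (v ∘ ℕ.suc) ∈ Until P Q))
until-expand {P = P} {Q = Q} {v = v} dP dQ = mk⇔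
  (unfold ∘ to (inf∈dp⇔ r))
  [ (λ q → from (inf∈dp⇔ r) (0 , q)) , fold ]
  where
  r = until-⋃-resp dP dQ

  unfold : inf v ∈ ⋃ ℕ (λ k → ((λ X → ▷ X ∩ P) ^ k) Q) →
           inf v ∈ Q ⊎ (inf v ∈ P × inf (v ∘ ℕ.suc) ∈ Until P Q)
  unfold (zero  , q)     = inj₁ q
  unfold (ℕ.suc k , u , p) = inj₂ (p , from (inf∈dp⇔ r) (k , u))

  fold : inf v ∈ P × inf (v ∘ ℕ.suc) ∈ Until P Q → inf v ∈ Until P Q
  fold (p , u) with to (inf∈dp⇔ r) u
  ... | k , u′ = from (inf∈dp⇔ r) (ℕ.suc k , u′ , p)

-- Each stage of the intersection gives its own disjunction, and the side taken could vary with `k`.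
-- Deciding `inf v ∈ P` first fixes one side for all stages; this is where excluded middle enters.
release-expand : ∀ {a} {A : Set a} {P Q : TraceSet A} {v} →
  ExcludedMiddle (suc a) → Definitive P → Definitive Q →
  inf v ∈ Release P Q ⇔ (inf v ∈ Q × (inf v ∈ P ⊎ inf (v ∘ ℕ.suc) ∈ Release P Q))
release-expand {A = A} {P} {Q} {v} em dP dQ = mk⇔ (λ h → h 0 , unfold h) fold
  where
  d : ∀ k → Definitive (((λ X → ▷ X ⊔ P) ^ k) Q)
  d = release-iterate-definitive dP dQ

  suc⇔ : ∀ k → inf v ∈ ((λ X → ▷ X ⊔ P) ^ ℕ.suc k) Q ⇔
               (inf (v ∘ ℕ.suc) ∈ ((λ X → ▷ X ⊔ P) ^ k) Q ⊎ inf v ∈ P)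
  suc⇔ k = inf∈⊔⇔ (▷-definitive (d k)) dP

  unfold : inf v ∈ Release P Q → inf v ∈ P ⊎ inf (v ∘ ℕ.suc) ∈ Release P Q
  unfold h with em {inf v ∈ P}
  ... | yes p = inj₁ p
  ... | no ¬p = inj₂ λ k →
    [ id , (λ p → contradiction p ¬p) ] (to (suc⇔ k) (h (ℕ.suc k)))

  fold : inf v ∈ Q × (inf v ∈ P ⊎ inf (v ∘ ℕ.suc) ∈ Release P Q) →
         inf v ∈ Release P Q
  fold (q , _)      zero    = q
  fold (_ , inj₁ p) (ℕ.suc k) = from (suc⇔ k) (inj₂ p)
  fold (_ , inj₂ h) (ℕ.suc k) = from (suc⇔ k) (inj₁ (h k))

-- Formula progression

⟦_⟧₃-definitive : (φ : Formula A) → ∀ b → Definitive (⟦ φ ⟧₃ b)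
⟦ ⊤ ⟧₃-definitive      T = Σ∞-definitive
⟦ ⊤ ⟧₃-definitive      F = ∅-definitive
⟦ atom p ⟧₃-definitive T = dp-definitive (First-resp λ σ≐τ → proj₁ σ≐τ)
⟦ atom p ⟧₃-definitive F = dp-definitive (First-resp λ σ≐τ p∉σ → p∉σ ∘ proj₂ σ≐τ)
⟦ ¬ φ ⟧₃-definitive    T = ⟦ φ ⟧₃-definitive F
⟦ ¬ φ ⟧₃-definitive    F = ⟦ φ ⟧₃-definitive T
⟦ φ ∧ ψ ⟧₃-definitive  T = ∩-definitive (⟦ φ ⟧₃-definitive T) (⟦ ψ ⟧₃-definitive T)
⟦ φ ∧ ψ ⟧₃-definitive  F = ⊔-definitive (⟦ φ ⟧₃-definitive F) (⟦ ψ ⟧₃-definitive F)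
⟦ ◯ φ ⟧₃-definitive    b = ▷-definitive (⟦ φ ⟧₃-definitive b)
⟦ φ 𝓤 ψ ⟧₃-definitive  T = until-definitive (⟦ φ ⟧₃-definitive T) (⟦ ψ ⟧₃-definitive T)
⟦ φ 𝓤 ψ ⟧₃-definitive  F = release-definitive (⟦ φ ⟧₃-definitive F) (⟦ ψ ⟧₃-definitive F)

inf∈atomT⇔ : ∀ (p : A) v → inf v ∈ ⟦ atom p ⟧₃ T ⇔ p ∈ v 0
inf∈atomT⇔ p v = mk⇔ proj₂ ((λ ()) ,_) ⇔-∘ inf∈dp⇔ (First-resp λ σ≐τ → proj₁ σ≐τ)

inf∈atomF⇔ : ∀ (p : A) v → inf v ∈ ⟦ atom p ⟧₃ F ⇔ p ∉ v 0
inf∈atomF⇔ p v = mk⇔ proj₂ ((λ ()) ,_) ⇔-∘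
             inf∈dp⇔ (First-resp λ σ≐τ p∉σ → p∉σ ∘ proj₂ σ≐τ)

-- Induction on the derivation, for both answers at once since negation exchanges them.
progress : ∀ {a} {A : Set a} → ExcludedMiddle (suc a) →
  {σ : State A} {φ φ′ : Formula A} → φ ⟶[ σ ] φ′ → ∀ b v →
  inf ((σ ∷ []) ++ω v) ∈ ⟦ φ ⟧₃ b ⇔ inf v ∈ ⟦ φ′ ⟧₃ b
progress em ⊤-step       T v = ⇔-id _
progress em ⊤-step       F v = ⇔-id _
progress em (∈-step p∈σ) T v = mk⇔ _ (λ _ → p∈σ) ⇔-∘ inf∈atomT⇔ _ _
progress em (∈-step p∈σ) F v = mk⇔ (contradiction p∈σ) (λ ()) ⇔-∘ inf∈atomF⇔ _ _
progress em (∉-step p∉σ) T v = mk⇔ (λ p∈σ → contradiction p∈σ p∉σ) (λ ()) ⇔-∘ inf∈atomT⇔ _ _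
progress em (∉-step p∉σ) F v = mk⇔ _ (λ _ → p∉σ) ⇔-∘ inf∈atomF⇔ _ _
progress em ◯-step       b v = ⇔-id _
progress em (¬-step p)   T v = progress em p F v
progress em (¬-step p)   F v = progress em p T v
progress em (∧-step p q) T v = progress em p T v ×-⇔ progress em q T v
progress em (∧-step {φ = φ} {φ′} {ψ} {ψ′} p q) F v = ⊔-cong-inf
  (⟦ φ ⟧₃-definitive F) (⟦ ψ ⟧₃-definitive F)
  (⟦ φ′ ⟧₃-definitive F) (⟦ ψ′ ⟧₃-definitive F)
  (progress em p F v) (progress em q F v)
-- For `T` the disjunction unfolds to `_⊔_`, matching the sum in the expansion law. The recursive
-- `𝓤` is already evaluated on the tail, hence the identity.
progress em (𝓤-step {φ = φ} {φ′} {ψ} {ψ′} p q) T v =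
  ⇔-sym (inf∈⊔⇔ (⟦ ψ′ ⟧₃-definitive T) (⟦ φ′ ∧ (φ 𝓤 ψ) ⟧₃-definitive T)) ⇔-∘
  ((progress em q T v ⊎-⇔ (progress em p T v ×-⇔ ⇔-id _)) ⇔-∘
   until-expand (⟦ φ ⟧₃-definitive T) (⟦ ψ ⟧₃-definitive T))
-- For `F` the roles are dual: the disjunction unfolds to `_∩_` and the inner conjunction to `_⊔_`.
progress em (𝓤-step {φ = φ} {φ′} {ψ} {ψ′} p q) F v =
  (progress em q F v ×-⇔
    (⇔-sym (inf∈⊔⇔ (⟦ φ′ ⟧₃-definitive F) (⟦ φ 𝓤 ψ ⟧₃-definitive F)) ⇔-∘
     (progress em p F v ⊎-⇔ ⇔-id _))) ⇔-∘
  release-expand em (⟦ φ ⟧₃-definitive F) (⟦ ψ ⟧₃-definitive F)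

progress* : ∀ {a} {A : Set a} → ExcludedMiddle (suc a) →
  {t : List (State A)} {φ φ′ : Formula A} → φ ⟶*[ t ] φ′ → ∀ b v →
  inf (t ++ω v) ∈ ⟦ φ ⟧₃ b ⇔ inf v ∈ ⟦ φ′ ⟧₃ b
progress* em done b v = ⇔-id _
progress* em (step {σ} {t} {φ} p ps) b v =
  progress* em ps b v ⇔-∘ (progress em p b (t ++ω v) ⇔-∘ mk⇔
    (⟦ φ ⟧₃-definitive b .resp cons≈)
    (⟦ φ ⟧₃-definitive b .resp (≈-sym cons≈)))
  where
  -- The two functions agree only pointwise, so membership is carried across by `resp`.
  cons≈ : inf ((σ ∷ t) ++ω v) ≈ inf ((σ ∷ []) ++ω (t ++ω v))
  cons≈ = inf (++ω-assoc (σ ∷ []) t v)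

-- The hypothesis speaks of infinite traces only. Finite members of `Y` come from `complete`: every
-- `u · inf v` is infinite, either `u` prepended to `v` or `u` itself.
∈⇔residual≐Σ∞ : ∀ {t : List (State A)} → Definitive X → Definitive Y →
  (∀ v → inf (t ++ω v) ∈ X ⇔ inf v ∈ Y) → fin t ∈ X ⇔ Y ≐ Σ∞
∈⇔residual≐Σ∞ {X = X} {Y = Y} {t = t} dX dY e = mk⇔
  (λ t∈X → _ , λ {u} _ → dY .complete u (total t∈X u))
  (λ (_ , Σ∞⊆Y) → dX .complete (fin t) λ v → from (e v) (Σ∞⊆Y tt))
  where
  total : fin t ∈ X → ∀ u v → u · inf v ∈ Y
  total t∈X (fin s) v = to (e (s ++ω v)) (dX .extend (fin t) _ t∈X)
  total t∈X (inf w) v = to (e w) (dX .extend (fin t) w t∈X)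

theorem11 : ∀ {a} → ExcludedMiddle (suc a) →
    {A : Set a} (t : List (State A)) (φ φ′ : Formula A) → φ ⟶*[ t ] φ′ →
    (fin t ∈ ⟦ φ ⟧₃ T ⇔ ⟦ φ′ ⟧₃ T ≐ Σ∞) ×
    (fin t ∈ ⟦ φ ⟧₃ F ⇔ ⟦ φ′ ⟧₃ F ≐ Σ∞)
theorem11 em t φ φ′ φ⟶φ′ = at T , at F
  where
  at : ∀ b → fin t ∈ ⟦ φ ⟧₃ b ⇔ ⟦ φ′ ⟧₃ b ≐ Σ∞
  at b = ∈⇔residual≐Σ∞ (⟦ φ ⟧₃-definitive b) (⟦ φ′ ⟧₃-definitive b)
                       (progress* em φ⟶φ′ b)
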